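{- Let $\ell \ge 2$ and $\rho \ge 1$. For every instance of the multi-level Steiner tree problem with $\ell$ levels, the top-down approach is an $\frac{\ell+1}{2}\rho$-approximation, the bottom-up approach is an $\ell\rho$-approximation, and the algorithm returning the cheaper of the two solutions is an $\frac{\ell+2}{3}\rho$-approximation; that is, $$\mathrm{TOP} \le \tfrac{\ell+1}{2}\,\rho\cdot \mathrm{OPT},\qquad \mathrm{BOT}\le \ell\rho\cdot\mathrm{OPT},\qquad \min\{\mathrm{TOP},\mathrm{BOT}\}\le \tfrac{\ell+2}{3}\,\rho\cdot\mathrm{OPT}.$$
   Context: Multi-level Steiner tree (MLST) problem: an instance is a connected undirected graph $G=(V,E)$ with edge weights $c\colon E\to\mathbb{R}^+$ and nested terminal sets $T_\ell\subset\dots\subset T_1\subseteq V$. A multi-level Steiner tree consists of nested edge sets $E_\ell\subseteq\dots\subseteq E_1\subseteq E$ such that $E_i$ spans (connects) $T_i$ for all $1\le i\le \ell$. Writing $c(F)=\sum_{e\in F}c(e)$, its cost is $\sum_{i=1}^\ell c(E_i)$. $\mathrm{OPT}$ denotes the minimum cost of an MLST. Steiner tree subroutine: for a graph with non-negative edge weights and a terminal set $T$, a Steiner tree is a tree in the graph that spans $T$. All Steiner trees below are computed with a subroutine that returns a Steiner tree of cost at most $\rho$ times the minimum cost of a Steiner tree for the given weights and terminals. Top-down approach: compute a Steiner tree $E_{\mathrm{TOP},\ell}$ for $T_\ell$. Then for $i=\ell-1,\dots,1$: set the weight of all edges of $E_{\mathrm{TOP},i+1}$ to $0$, compute with the subroutine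 a Steiner tree for $T_i$ in the reweighted graph, and let $E_{\mathrm{TOP},i}$ be the union of $E_{\mathrm{TOP},i+1}$ and the edges of this tree. The cost (with original weights) of the resulting MLST $E_{\mathrm{TOP},\ell}\subseteq\dots\subseteq E_{\mathrm{TOP},1}$ is $\mathrm{TOP}$. Bottom-up approach: compute a Steiner tree $E_{\mathrm{BOT},1}$ for $T_1$ and for $i\geq 2$ let $E_{\mathrm{BOT},i}$ be the smallest subtree of $E_{\mathrm{BOT},1}$ that spans $T_i$. The cost of the resulting MLST is $\mathrm{BOT}$. -}

module Defs where

open import Algebra.Bundles using (CommutativeRing)
open import Algebra.Structures using (IsCommutativeRing)
import Algebra.Construct.NaturalChoice.Min as Min
import Algebra.Properties.Semiring.Mult as Mult
import Algebra.Properties.CommutativeMonoid.Sum as Sum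
open import Data.Bool using (true; false; if_then_else_)
open import Data.Fin as Fin using (Fin; zero; suc; inject₁; fromℕ)
open import Data.Fin.Subset using (Subset; _∈_; _⊆_; _∪_; ⊤; Nonempty)
open import Data.Nat as ℕ using (ℕ; zero; suc)
open import Data.Product using (∃; _×_; _,_; proj₁; proj₂)
open import Data.Sum using (_⊎_)
open import Data.Vec using (lookup)
open import Data.Vec.Functional using (Vector; head; tail; _∷_; [])
open import Function using (_∘_)
open import Function.Definitions using (Injective)
open import Level as Level using (Level; _⊔_)
open import Relation.Binary.Bundles using (TotalOrder)
open import Relation.Binary.Structures using (IsTotalOrder)
open import Relation.Binary.Construct.Closure.ReflexiveTransitive using (Star)
import Relation.Binary.Construct.NonStrictToStrict as Strict
open import Relation.Binary.PropositionalEquality using (_≡_)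
open import Relation.Nullary using (¬_)

-- Totally ordered fields.  Weights and approximation factors are taken in an
-- arbitrary one, since the library has no real numbers; only the ordered-field
-- structure of ℝ is ever used.

record OrderedField (a b r : Level) : Set (Level.suc (a ⊔ b ⊔ r)) where
  infix  4 _≈_ _≤_
  infixl 6 _+_
  infixl 7 _*_ _/_
  infix  8 -_ _⁻¹
  field
    Carrier           : Set a
    _≈_               : Carrier → Carrier → Set b
    _≤_               : Carrier → Carrier → Set r
    _+_ _*_           : Carrier → Carrier → Carrier
    -_                : Carrier → Carrier
    0# 1#             : Carrier
    -- As usual in formal developments ⁻¹ is total; nothing is assumed about
    -- its value at 0#.
    _⁻¹               : Carrier → Carrier
    isCommutativeRing : IsCommutativeRing _≈_ _+_ _*_ -_ 0# 1#
    isTotalOrder      : IsTotalOrder _≈_ _≤_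
    0≉1               : ¬ (0# ≈ 1#)
    *-inverseʳ        : ∀ x → ¬ (x ≈ 0#) → x * x ⁻¹ ≈ 1#
    +-monoˡ-≤         : ∀ z {x y} → x ≤ y → x + z ≤ y + z
    *-nonNeg          : ∀ {x y} → 0# ≤ x → 0# ≤ y → 0# ≤ x * y

  commutativeRing : CommutativeRing a b
  commutativeRing = record { isCommutativeRing = isCommutativeRing }

  totalOrder : TotalOrder a b r
  totalOrder = record { isTotalOrder = isTotalOrder }

  open IsTotalOrder isTotalOrder public
    using () renaming (refl to ≤-refl)
  open Strict _≈_ _≤_ public using (_<_)
  open Min totalOrder public using (_⊓_)
  open Sum (CommutativeRing.+-commutativeMonoid commutativeRing) public
    using (sum)

  _/_ : Carrier → Carrier → Carrier
  x / y = x * y ⁻¹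

  fromNat : ℕ → Carrier
  fromNat n = Mult._×_ (CommutativeRing.semiring commutativeRing) n 1#

  record IsMinimum {p q} {A : Set p} (P : A → Set q) (f : A → Carrier)
                   (μ : Carrier) : Set (p ⊔ q ⊔ b ⊔ r) where
    field
      attained   : ∃ λ x → P x × f x ≈ μ
      lowerBound : ∀ x → P x → μ ≤ f x

-- Finite simple graphs on the vertex set Fin ∣V∣.  Each edge {u , v} is listed
-- exactly once, as the pair (u , v) with u < v; the order of the endpoints
-- carries no further meaning (see Joins).

record Graph : Set where
  field
    ∣V∣ ∣E∣ : ℕ
    ends    : Fin ∣E∣ → Fin ∣V∣ × Fin ∣V∣
    ordered : ∀ e → proj₁ (ends e) Fin.< proj₂ (ends e)
    simple  : Injective _≡_ _≡_ ends

  Vertex : Set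
  Vertex = Fin ∣V∣

  Edge : Set
  Edge = Fin ∣E∣

  VertexSet : Set
  VertexSet = Subset ∣V∣

  EdgeSet : Set
  EdgeSet = Subset ∣E∣

  Joins : Edge → Vertex → Vertex → Set
  Joins e u v = ends e ≡ (u , v) ⊎ ends e ≡ (v , u)

  Adjacent : EdgeSet → Vertex → Vertex → Set
  Adjacent F u v = ∃ λ e → e ∈ F × Joins e u v

  Linked : EdgeSet → Vertex → Vertex → Set
  Linked F = Star (Adjacent F)

  Spans : EdgeSet → VertexSet → Set
  Spans F T = ∀ {u v} → u ∈ T → v ∈ T → Linked F u v

  Connected : Set
  Connected = Spans ⊤ ⊤

  -- A cycle x₀ x₁ … x₂₊ₖ x₀ with at least three, pairwise distinct, vertices.
  record Cycle (F : EdgeSet) : Set where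
    field
      k        : ℕ
      x        : Fin (3 ℕ.+ k) → Vertex
      distinct : Injective _≡_ _≡_ x
      step     : ∀ (i : Fin (2 ℕ.+ k)) → Adjacent F (x (inject₁ i)) (x (suc i))
      close    : Adjacent F (x (fromℕ (2 ℕ.+ k))) (x zero)

  record Tree : Set where
    field
      vertices  : VertexSet
      edges     : EdgeSet
      incident  : ∀ {e} → e ∈ edges →
                  proj₁ (ends e) ∈ vertices × proj₂ (ends e) ∈ vertices
      nonempty  : Nonempty vertices
      connected : Spans edges vertices
      acyclic   : ¬ Cycle edges

  open Tree public using (vertices; edges)

  IsSteinerTree : VertexSet → Tree → Set
  IsSteinerTree T S = T ⊆ vertices S

  _IsSubtreeOf_ : Tree → Tree → Set
  R IsSubtreeOf S = vertices R ⊆ vertices S × edges R ⊆ edges S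

  -- "Smallest" is least with respect to inclusion of edge sets.
  record IsSmallestSubtree (S : Tree) (T : VertexSet) (R : Tree) : Set where
    field
      subtree : R IsSubtreeOf S
      spans   : IsSteinerTree T R
      least   : ∀ R′ → R′ IsSubtreeOf S → IsSteinerTree T R′ → edges R ⊆ edges R′

module _ {a b r : Level} (K : OrderedField a b r) where

  open OrderedField K

  module _ (G : Graph) where

    open Graph G

    record Weighting : Set (a ⊔ r) where
      field
        weight : Edge → Carrier
        nonNeg : ∀ e → 0# ≤ weight e

    open Weighting public

    cost : Weighting → EdgeSet → Carrier
    cost w F = sum λ e → if lookup F e then weight w e else 0#

    zeroOn : EdgeSet → Weighting → Weighting
    zeroOn F w .weight e = if lookup F e then 0# else weight w e
    zeroOn F w .nonNeg e with lookup F e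
    ... | true  = ≤-refl
    ... | false = nonNeg w e

    IsMinSteinerCost : Weighting → VertexSet → Carrier → Set (b ⊔ r)
    IsMinSteinerCost w T = IsMinimum (IsSteinerTree T) (cost w ∘ edges)

    record Subroutine (ρ : Carrier) : Set (a ⊔ b ⊔ r) where
      field
        solve   : Weighting → VertexSet → Tree
        steiner : ∀ w T → IsSteinerTree T (solve w T)
        approx  : ∀ w T → ∃ λ μ → IsMinSteinerCost w T μ ×
                                  cost w (edges (solve w T)) ≤ ρ * μ

  -- Levels are indexed from 0: index i : Fin ℓ stands for level i + 1, so that
  -- index zero is the level with the largest terminal set.

  record Instance (ℓ : ℕ) : Set (a ⊔ b ⊔ r) where
    field
      graph     : Graph
      connected : Graph.Connected graph
      c         : Graph.Edge graph → Carrier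
      positive  : ∀ e → 0# < c e
      terminals : Vector (Graph.VertexSet graph) ℓ
      nested    : ∀ {i j} → i Fin.≤ j → terminals j ⊆ terminals i

    open Graph graph public

    weighting : Weighting graph
    weighting = record { weight = c ; nonNeg = λ e → proj₁ (positive e) }

    record IsMLST (E : Vector EdgeSet ℓ) : Set where
      field
        nestedEdges : ∀ {i j} → i Fin.≤ j → E j ⊆ E i
        spans       : ∀ i → Spans (E i) (terminals i)

    totalCost : Vector EdgeSet ℓ → Carrier
    totalCost E = sum λ i → cost graph weighting (E i)

    IsOPT : Carrier → Set (b ⊔ r)
    IsOPT = IsMinimum IsMLST totalCost

  module _ {G : Graph} {ρ : Carrier} (A : Subroutine G ρ) (w : Weighting G) where

    open Graph G
    open Subroutine A

    buyLevel : ∀ {k} → VertexSet → Vector EdgeSet (suc k) → Vector EdgeSet (suc (suc k))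
    buyLevel T E = (head E ∪ edges (solve (zeroOn G (head E) w) T)) ∷ E

    topDown : ∀ {k} → Vector VertexSet (suc k) → Vector EdgeSet (suc k)
    topDown {zero}  T = edges (solve w (head T)) ∷ []
    topDown {suc k} T = buyLevel (head T) (topDown {k} (tail T))

    record BottomUp {k} (T : Vector VertexSet (suc k)) : Set where
      field
        higher   : Vector Tree k
        smallest : ∀ i → IsSmallestSubtree (solve w (head T)) (T (suc i)) (higher i)

      tree : Vector Tree (suc k)
      tree = solve w (head T) ∷ higher

  module _ {k : ℕ} (I : Instance (suc k)) {ρ : Carrier}
           (A : Subroutine (Instance.graph I) ρ) where

    open Instance I

    TOP : Carrier
    TOP = totalCost (topDown A weighting terminals)

    BOT : BottomUp A weighting terminals → Carrier
    BOT B = totalCost (edges ∘ BottomUp.tree B)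

{-# OPTIONS --safe #-}

-- Let cᵢ be the cost of level i of an optimal solution.  Level i of that
-- solution contains a Steiner tree for Tᵢ, so the edges newly bought by the
-- top-down approach at level i cost at most ρ cᵢ; they are paid for i times,
-- whence TOP ≤ ρ Σ i cᵢ.  All levels of the bottom-up solution lie in one tree
-- of cost at most ρ c₁, whence BOT ≤ ℓ ρ c₁.  As c₁ ≥ … ≥ c_ℓ, Chebyshev's sum
-- inequality gives 2 Σ i cᵢ ≤ (ℓ + 1) Σ cᵢ; applied to c₂, …, c_ℓ it gives
-- 2 Σ i cᵢ + ℓ c₁ ≤ (ℓ + 2) Σ cᵢ, which bounds 2 TOP + BOT ≥ 3 min(TOP, BOT).

module Submission where

open import Defs
open import Algebra.Bundles using (CommutativeRing)
import Algebra.Construct.NaturalChoice.Min as Min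
import Algebra.Properties.CommutativeSemigroup as CommutativeSemigroupProperties
import Algebra.Properties.Ring as RingProperties
import Algebra.Properties.Semiring.Mult as Mult
import Algebra.Properties.Semiring.Sum as Sum
open import Data.Bool using (true; false; _∨_; if_then_else_)
open import Data.Fin as Fin using (zero; suc; inject₁; fromℕ)
open import Data.Fin.Properties using (_≟_; any?; toℕ-inject₁)
open import Data.Fin.Relation.Unary.Top using (view; ‵fromℕ; ‵inject₁)
open import Data.Fin.Subset using (_∈_; _∉_; _⊆_; _⊃_; _∪_; ⁅_⁆; ⊥; Nonempty)
open import Data.Fin.Subset.Induction using (Acc; acc; ⊃-wellFounded)
open import Data.Fin.Subset.Properties
  using (_∈?_; nonempty?; ∉⊥; x∈⁅x⁆; x∈⁅y⁆⇒x≡y; p⊆p∪q; q⊆p∪q; x∈p∪q⁻)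
open import Data.Nat as ℕ using (ℕ; zero; suc)
open import Data.Nat.Properties using (m≢1+n+m)
open import Data.Product using (∃; ∃₂; _×_; _,_; proj₁; proj₂)
open import Data.Product.Properties using (≡-dec)
open import Data.Sum using (_⊎_; inj₁; inj₂; swap)
open import Data.Vec using (lookup)
open import Data.Vec.Functional using (Vector; head; tail)
open import Data.Vec.Properties using ([]=⇒lookup; lookup⇒[]=; lookup-zipWith)
open import Function using (_∘_)
open import Level using (Level)
open import Relation.Binary.Bundles using (TotalOrder)
import Relation.Binary.Reasoning.PartialOrder as PartialOrderReasoning
open import Relation.Binary.Construct.Closure.ReflexiveTransitive as Star using (ε; _◅_; _◅◅_)
open import Relation.Binary.PropositionalEquality as ≡ using (_≡_; _≢_)
open import Relation.Nullary using (¬_; Dec; yes; no; contradiction; ¬?; _×-dec_; _⊎-dec_)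

-- Trees in finite graphs: a spanning edge set contains a Steiner tree.

module _ (G : Graph) where

  open Graph G

  joins-endpoint : ∀ {e u v x} → Joins e u v → Joins e x v → x ≡ u
  joins-endpoint (inj₁ p) (inj₁ q) = ≡.cong proj₁ (≡.trans (≡.sym q) p)
  -- In the two mixed cases the equated pairs collapse `u`, `v` and `x` into one vertex.
  joins-endpoint (inj₁ p) (inj₂ q) with ≡.refl ← ≡.trans (≡.sym q) p = ≡.refl
  joins-endpoint (inj₂ p) (inj₁ q) with ≡.refl ← ≡.trans (≡.sym q) p = ≡.refl
  joins-endpoint (inj₂ p) (inj₂ q) = ≡.cong proj₂ (≡.trans (≡.sym q) p)

  joins-meets : ∀ {e u v x y} → Joins e u v → Joins e x y → x ≡ v ⊎ y ≡ v
  joins-meets (inj₁ p) (inj₁ q) = inj₂ (≡.cong proj₂ (≡.trans (≡.sym q) p))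
  joins-meets (inj₁ p) (inj₂ q) = inj₁ (≡.cong proj₂ (≡.trans (≡.sym q) p))
  joins-meets (inj₂ p) (inj₁ q) = inj₁ (≡.cong proj₁ (≡.trans (≡.sym q) p))
  joins-meets (inj₂ p) (inj₂ q) = inj₂ (≡.cong proj₁ (≡.trans (≡.sym q) p))

  joins-ends : ∀ {e u v X} → Joins e u v → u ∈ X → v ∈ X →
    proj₁ (ends e) ∈ X × proj₂ (ends e) ∈ X
  joins-ends {X = X} (inj₁ p) u∈X v∈X =
    ≡.subst (λ xy → proj₁ xy ∈ X × proj₂ xy ∈ X) (≡.sym p) (u∈X , v∈X)
  joins-ends {X = X} (inj₂ p) u∈X v∈X =
    ≡.subst (λ xy → proj₁ xy ∈ X × proj₂ xy ∈ X) (≡.sym p) (v∈X , u∈X)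

  adjacent-sym : ∀ {F u v} → Adjacent F u v → Adjacent F v u
  adjacent-sym (e , e∈F , j) = e , e∈F , swap j

  adjacent-mono : ∀ {F F′ u v} → F ⊆ F′ → Adjacent F u v → Adjacent F′ u v
  adjacent-mono F⊆F′ (e , e∈F , j) = e , F⊆F′ e∈F , j

  adjacent? : ∀ F u v → Dec (Adjacent F u v)
  adjacent? F u v = any? λ e →
    (e ∈? F) ×-dec (≡-dec _≟_ _≟_ (ends e) (u , v) ⊎-dec ≡-dec _≟_ _≟_ (ends e) (v , u))

  incidentʳ : ∀ (S : Tree) {u v} → Adjacent (edges S) u v → v ∈ vertices S
  incidentʳ S (e , e∈S , inj₁ p) = ≡.subst (_∈ vertices S) (≡.cong proj₂ p)
    (proj₂ (Tree.incident S e∈S))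
  incidentʳ S (e , e∈S , inj₂ p) = ≡.subst (_∈ vertices S) (≡.cong proj₁ p)
    (proj₁ (Tree.incident S e∈S))

  -- Predecessor and successor along the cycle differ because its length is at least three. They are
  -- returned as positions, so that `distinct` can later separate the two vertices.
  cycle-neighbours : ∀ {F} (C : Cycle F) → let open Cycle C in ∀ i →
    ∃₂ λ j j′ → j ≢ j′ × Adjacent F (x j) (x i) × Adjacent F (x j′) (x i)
  cycle-neighbours C zero =
    suc zero , fromℕ _ , (λ ()) , adjacent-sym (Cycle.step C zero) , Cycle.close C
  cycle-neighbours C (suc i) with view i
  -- The last position: its successor wraps around to `zero` through the closing edge.
  ... | ‵fromℕ =
    inject₁ (fromℕ _) , zero , (λ ()) , Cycle.step C (fromℕ _) , adjacent-sym (Cycle.close C)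
  -- An interior position `suc (inject₁ j)`: its two neighbours differ by 2 as numbers.
  ... | ‵inject₁ j =
    inject₁ (inject₁ j) , suc (suc j) , inject₁²j≢2+j
    , Cycle.step C (inject₁ j) , adjacent-sym (Cycle.step C (suc j))
    where
    inject₁²j≢2+j : inject₁ (inject₁ j) ≢ suc (suc j)
    inject₁²j≢2+j eq = m≢1+n+m (Fin.toℕ j)
      (≡.trans (≡.sym (≡.trans (toℕ-inject₁ (inject₁ j)) (toℕ-inject₁ j))) (≡.cong Fin.toℕ eq))

  -- The seed from which `grow` starts.
  singleton : Vertex → Tree
  singleton v = record
    { vertices  = ⁅ v ⁆
    ; edges     = ⊥
    ; incident  = λ e∈⊥ → contradiction e∈⊥ ∉⊥
    ; nonempty  = v , x∈⁅x⁆ v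
    ; connected = λ x∈ y∈ →
        ≡.subst₂ (Linked ⊥) (≡.sym (x∈⁅y⁆⇒x≡y v x∈)) (≡.sym (x∈⁅y⁆⇒x≡y v y∈)) ε
    ; acyclic   = λ C → ∉⊥ (proj₁ (proj₂ (Cycle.close C)))
    }

  -- A cycle through the new leaf v would give v two distinct neighbours, but
  -- its only neighbour is u; a cycle avoiding v lies in the old tree.
  module _ (S : Tree) {e u v} (e-joins : Joins e u v)
           (u∈S : u ∈ vertices S) (v∉S : v ∉ vertices S) where

    private
      F⁺ : EdgeSet
      F⁺ = edges S ∪ ⁅ e ⁆

      V⁺ : VertexSet
      V⁺ = vertices S ∪ ⁅ v ⁆

    leaf-neighbour : ∀ {x} → Adjacent F⁺ x v → x ≡ u
    leaf-neighbour (f , f∈F⁺ , j) with x∈p∪q⁻ (edges S) ⁅ e ⁆ f∈F⁺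
    ... | inj₁ f∈S = contradiction (incidentʳ S (f , f∈S , j)) v∉S
    ... | inj₂ f∈e with ≡.refl ← x∈⁅y⁆⇒x≡y e f∈e = joins-endpoint e-joins j

    adjacent-avoiding : ∀ {x y} → x ≢ v → y ≢ v → Adjacent F⁺ x y → Adjacent (edges S) x y
    adjacent-avoiding x≢v y≢v (f , f∈F⁺ , j) with x∈p∪q⁻ (edges S) ⁅ e ⁆ f∈F⁺
    ... | inj₁ f∈S = f , f∈S , j
    ... | inj₂ f∈e with ≡.refl ← x∈⁅y⁆⇒x≡y e f∈e with joins-meets e-joins j
    ...   | inj₁ x≡v = contradiction x≡v x≢v
    ...   | inj₂ y≡v = contradiction y≡v y≢v

    attach-acyclic : ¬ Cycle F⁺
    attach-acyclic C with any? (λ i → Cycle.x C i ≟ v)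
    ... | yes (i , ≡.refl) =
      let j , j′ , j≢j′ , a , a′ = cycle-neighbours C i
      in j≢j′ (Cycle.distinct C (≡.trans (leaf-neighbour a) (≡.sym (leaf-neighbour a′))))
    ... | no avoids = Tree.acyclic S record
      { k        = Cycle.k C
      ; x        = Cycle.x C
      ; distinct = Cycle.distinct C
      ; step     = λ i → adjacent-avoiding (x≢v _) (x≢v _) (Cycle.step C i)
      ; close    = adjacent-avoiding (x≢v _) (x≢v _) (Cycle.close C)
      }
      where
      x≢v : ∀ i → Cycle.x C i ≢ v
      x≢v i eq = avoids (i , eq)

    attach : Tree
    attach = record
      { vertices  = V⁺
      ; edges     = F⁺
      ; incident  = incident⁺
      ; nonempty  = u , p⊆p∪q _ u∈S
      -- Any two vertices are linked by way of the attachment vertex `u`.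
      ; connected = λ x∈ y∈ → linked-u x∈ ◅◅ Star.reverse adjacent-sym (linked-u y∈)
      ; acyclic   = attach-acyclic
      }
      where
      v∈V⁺ : v ∈ V⁺
      v∈V⁺ = q⊆p∪q (vertices S) ⁅ v ⁆ (x∈⁅x⁆ v)

      incident⁺ : ∀ {f} → f ∈ F⁺ → proj₁ (ends f) ∈ V⁺ × proj₂ (ends f) ∈ V⁺
      incident⁺ f∈F⁺ with x∈p∪q⁻ (edges S) ⁅ e ⁆ f∈F⁺
      ... | inj₁ f∈S =
        p⊆p∪q _ (proj₁ (Tree.incident S f∈S)) , p⊆p∪q _ (proj₂ (Tree.incident S f∈S))
      ... | inj₂ f∈e with ≡.refl ← x∈⁅y⁆⇒x≡y e f∈e =
        joins-ends e-joins (p⊆p∪q _ u∈S) v∈V⁺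

      linked-u : ∀ {x} → x ∈ V⁺ → Linked F⁺ x u
      linked-u x∈V⁺ with x∈p∪q⁻ (vertices S) ⁅ v ⁆ x∈V⁺
      ... | inj₁ x∈S = Star.map (adjacent-mono (p⊆p∪q _)) (Tree.connected S x∈S u∈S)
      ... | inj₂ x∈v with ≡.refl ← x∈⁅y⁆⇒x≡y v x∈v =
        (e , q⊆p∪q (edges S) ⁅ e ⁆ (x∈⁅x⁆ e) , swap e-joins) ◅ ε

  Closed : EdgeSet → VertexSet → Set
  Closed F X = ∀ {u v} → Adjacent F u v → u ∈ X → v ∈ X

  closed-linked : ∀ {F X u v} → Closed F X → Linked F u v → u ∈ X → v ∈ X
  closed-linked closed ε         u∈X = u∈X
  closed-linked closed (a ◅ l) u∈X = closed-linked closed l (closed a u∈X)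

  -- As long as some edge of `F` leaves the tree, its outer endpoint is attached as a new leaf. The
  -- vertex set strictly increases inside a finite set, so the recursion is well-founded; when no
  -- such edge remains, the vertex set is closed under `F`-adjacency.
  grow : ∀ F S → Acc _⊃_ (vertices S) → edges S ⊆ F →
    ∃ λ R → edges R ⊆ F × vertices S ⊆ vertices R × Closed F (vertices R)
  grow F S (acc rec) S⊆F
    with any? (λ u → any? λ v → adjacent? F u v ×-dec (u ∈? vertices S) ×-dec ¬? (v ∈? vertices S))
  ... | no none = S , S⊆F , (λ x∈S → x∈S) , closed
    where
    closed : Closed F (vertices S)
    closed {u} {v} a u∈S with v ∈? vertices S
    ... | yes v∈S = v∈S
    ... | no  v∉S = contradiction (u , v , a , u∈S , v∉S) none
  ... | yes (u , v , (e , e∈F , j) , u∈S , v∉S) =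
    let R , R⊆F , S⁺⊆R , closed = grow F S⁺ (rec S⁺⊃S) S⁺⊆F
    in R , R⊆F , (λ x∈S → S⁺⊆R (p⊆p∪q _ x∈S)) , closed
    where
    S⁺ : Tree
    S⁺ = attach S j u∈S v∉S

    S⁺⊃S : vertices S⁺ ⊃ vertices S
    S⁺⊃S = p⊆p∪q _ , v , q⊆p∪q (vertices S) ⁅ v ⁆ (x∈⁅x⁆ v) , v∉S

    S⁺⊆F : edges S⁺ ⊆ F
    S⁺⊆F f∈S⁺ with x∈p∪q⁻ (edges S) ⁅ e ⁆ f∈S⁺
    ... | inj₁ f∈S = S⊆F f∈S
    ... | inj₂ f∈e with ≡.refl ← x∈⁅y⁆⇒x≡y e f∈e = e∈F

  -- A tree grown inside `F` from one terminal is closed under `F`-adjacency, hence absorbs every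
  -- vertex linked to that terminal, in particular all of `T`.
  spans⇒steinerTree : ∀ {F T} → Spans F T → Vertex → ∃ λ S → edges S ⊆ F × IsSteinerTree T S
  spans⇒steinerTree {F} {T} spans w = contains (nonempty? T)
    where
    component : ∀ r → ∃ λ R →
      edges R ⊆ F × vertices (singleton r) ⊆ vertices R × Closed F (vertices R)
    component r = grow F (singleton r) (⊃-wellFounded _) (λ e∈⊥ → contradiction e∈⊥ ∉⊥)

    contains : Dec (Nonempty T) → ∃ λ S → edges S ⊆ F × IsSteinerTree T S
    contains (yes (r , r∈T)) =
      let R , R⊆F , r∈R , closed = component r
      in R , R⊆F , λ t∈T → closed-linked closed (spans r∈T t∈T) (r∈R (x∈⁅x⁆ r))
    -- Without terminals any tree will do, but a tree needs a vertex; `w` supplies it.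
    contains (no empty) =
      let R , R⊆F , _ = component w
      in R , R⊆F , λ t∈T → contradiction (_ , t∈T) empty

-- Arithmetic in ordered fields and finite sums.

module OrderedFieldProperties {a b r : Level} (K : OrderedField a b r) where

  open OrderedField K public hiding (sum; isTotalOrder; ≤-refl)
  open CommutativeRing commutativeRing public
    using (ring; semiring; +-commutativeSemigroup; sym; trans;
           +-cong; +-congˡ; +-congʳ; +-comm; +-assoc; +-identityˡ; +-identityʳ;
           -‿cong; -‿inverseˡ; -‿inverseʳ;
           *-congˡ; *-congʳ; *-comm; *-assoc; *-identityˡ; *-identityʳ; distribˡ; zeroʳ)
  open TotalOrder totalOrder public
    using (poset; total; antisym; ≤-respˡ-≈; ≤-respʳ-≈)
    renaming (refl to ≤-refl; trans to ≤-trans; reflexive to ≤-reflexive)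
  open Mult semiring public
    using (×-congʳ; ×-homo-1; ×-homo-+; ×-comm-*; ×-assoc-*)
    renaming (_×_ to _·_)
  open Sum semiring public using (sum; ∑-distrib-+)
  open RingProperties ring using (-‿distribˡ-*; -‿involutive)
  open CommutativeSemigroupProperties +-commutativeSemigroup public using (interchange)
  open Min totalOrder public using (x⊓y≤x; x⊓y≤y)
  open PartialOrderReasoning poset public

  +-monoʳ-≤ : ∀ z {x y} → x ≤ y → z + x ≤ z + y
  +-monoʳ-≤ z {x} {y} x≤y = begin
    z + x  ≈⟨ +-comm z x ⟩
    x + z  ≤⟨ +-monoˡ-≤ z x≤y ⟩
    y + z  ≈⟨ +-comm y z ⟩
    z + y  ∎

  +-mono-≤ : ∀ {u v x y} → u ≤ v → x ≤ y → u + x ≤ v + y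
  +-mono-≤ u≤v x≤y = ≤-trans (+-monoˡ-≤ _ u≤v) (+-monoʳ-≤ _ x≤y)

  x≤y⇒0≤y-x : ∀ {x y} → x ≤ y → 0# ≤ y + - x
  x≤y⇒0≤y-x {x} x≤y = ≤-respˡ-≈ (-‿inverseʳ x) (+-monoˡ-≤ (- x) x≤y)

  -- The product of `z` with the nonnegative difference of `y` and `x` is nonnegative; adding
  -- `z * x` to it yields `z * y`.
  *-monoˡ-≤-nonNeg : ∀ {x y z} → 0# ≤ z → x ≤ y → z * x ≤ z * y
  *-monoˡ-≤-nonNeg {x} {y} {z} 0≤z x≤y = begin
    z * x                    ≈⟨ +-identityˡ _ ⟨
    0# + z * x               ≤⟨ +-monoˡ-≤ _ (*-nonNeg 0≤z (x≤y⇒0≤y-x x≤y)) ⟩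
    z * (y + - x) + z * x    ≈⟨ distribˡ z (y + - x) x ⟨
    z * (y + - x + x)        ≈⟨ *-congˡ (trans (+-assoc y (- x) x) (+-congˡ (-‿inverseˡ x))) ⟩
    z * (y + 0#)             ≈⟨ *-congˡ (+-identityʳ y) ⟩
    z * y                    ∎

  -- Otherwise `- 1#` would be nonnegative, and so would its square, which is `1#`.
  0≤1 : 0# ≤ 1#
  0≤1 with total 0# 1#
  ... | inj₁ 0≤1 = 0≤1
  ... | inj₂ 1≤0 = ≤-respʳ-≈ [-1]²≈1 (*-nonNeg 0≤-1 0≤-1)
    where
    0≤-1 : 0# ≤ - 1#
    0≤-1 = ≤-respʳ-≈ (+-identityˡ _) (x≤y⇒0≤y-x 1≤0)

    [-1]²≈1 : - 1# * - 1# ≈ 1#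
    [-1]²≈1 = trans (sym (-‿distribˡ-* 1# (- 1#))) (trans (-‿cong (*-identityˡ _)) (-‿involutive 1#))

  1≰0 : ¬ (1# ≤ 0#)
  1≰0 1≤0 = 0≉1 (antisym 0≤1 1≤0)

  ·-mono-≤ : ∀ n {x y} → x ≤ y → n · x ≤ n · y
  ·-mono-≤ zero    x≤y = ≤-refl
  ·-mono-≤ (suc n) x≤y = +-mono-≤ x≤y (·-mono-≤ n x≤y)

  ·-distrib-+ : ∀ n x y → n · (x + y) ≈ n · x + n · y
  ·-distrib-+ zero    x y = sym (+-identityˡ 0#)
  ·-distrib-+ (suc n) x y = trans (+-congˡ (·-distrib-+ n x y)) (interchange x y (n · x) (n · y))

  ·-nonNeg : ∀ n {x} → 0# ≤ x → 0# ≤ n · x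
  ·-nonNeg zero    0≤x = ≤-refl
  ·-nonNeg (suc n) 0≤x = ≤-respˡ-≈ (+-identityˡ 0#) (+-mono-≤ 0≤x (·-nonNeg n 0≤x))

  fromNat-* : ∀ n x → fromNat n * x ≈ n · x
  fromNat-* n x = trans (×-assoc-* n 1# x) (×-congʳ n (*-identityˡ x))

  1≤fromNat : ∀ n → 1# ≤ fromNat (suc n)
  1≤fromNat n = ≤-respˡ-≈ (+-identityʳ 1#) (+-monoʳ-≤ 1# (·-nonNeg n 0≤1))

  -- The order forces characteristic zero: positive naturals are at least `1#`, hence invertible.
  fromNat-inverse : ∀ n → fromNat (suc n) * fromNat (suc n) ⁻¹ ≈ 1#
  fromNat-inverse n = *-inverseʳ _ λ n≈0 → 1≰0 (≤-respʳ-≈ n≈0 (1≤fromNat n))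

  fromNat⁻¹-nonNeg : ∀ n → 0# ≤ fromNat (suc n) ⁻¹
  fromNat⁻¹-nonNeg n with total 0# (fromNat (suc n) ⁻¹)
  ... | inj₁ 0≤n⁻¹ = 0≤n⁻¹
  ... | inj₂ n⁻¹≤0 = contradiction 1≤0 1≰0
    where
    1≤0 : 1# ≤ 0#
    1≤0 = begin
      1#                                   ≈⟨ fromNat-inverse n ⟨
      fromNat (suc n) * fromNat (suc n) ⁻¹ ≤⟨ *-monoˡ-≤-nonNeg (≤-trans 0≤1 (1≤fromNat n)) n⁻¹≤0 ⟩
      fromNat (suc n) * 0#                 ≈⟨ zeroʳ _ ⟩
      0#                                   ∎

  -- The counting arguments work with natural multiples only; this converts their outcome into the
  -- fractions of the theorem.
  ≤-divide : ∀ n m {x y} → suc n · x ≤ m · y → x ≤ fromNat m / fromNat (suc n) * y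
  ≤-divide n m {x} {y} nx≤my = begin
    x                                          ≈⟨ *-identityˡ x ⟨
    1# * x                                     ≈⟨ *-congʳ (fromNat-inverse n) ⟨
    fromNat (suc n) * fromNat (suc n) ⁻¹ * x   ≈⟨ cancel (suc n) x ⟩
    fromNat (suc n) ⁻¹ * (suc n · x)           ≤⟨ *-monoˡ-≤-nonNeg (fromNat⁻¹-nonNeg n) nx≤my ⟩
    fromNat (suc n) ⁻¹ * (m · y)               ≈⟨ cancel m y ⟨
    fromNat m / fromNat (suc n) * y            ∎
    where
    cancel : ∀ i z → fromNat i * fromNat (suc n) ⁻¹ * z ≈ fromNat (suc n) ⁻¹ * (i · z)
    cancel i z = trans (*-congʳ (*-comm _ _)) (trans (*-assoc _ _ z) (*-congˡ (fromNat-* i z)))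

  sum-mono-≤ : ∀ {n} {f g : Vector Carrier n} → (∀ i → f i ≤ g i) → sum f ≤ sum g
  sum-mono-≤ {zero}  f≤g = ≤-refl
  sum-mono-≤ {suc n} f≤g = +-mono-≤ (f≤g zero) (sum-mono-≤ (f≤g ∘ suc))

  sum-≤-· : ∀ {n} {f : Vector Carrier n} {x} → (∀ i → f i ≤ x) → sum f ≤ n · x
  sum-≤-· {zero}  f≤x = ≤-refl
  sum-≤-· {suc n} f≤x = +-mono-≤ (f≤x zero) (sum-≤-· (f≤x ∘ suc))

  sum-nonNeg : ∀ {n} {f : Vector Carrier n} → (∀ i → 0# ≤ f i) → 0# ≤ sum f
  sum-nonNeg {zero}  0≤f = ≤-refl
  sum-nonNeg {suc n} 0≤f = ≤-respˡ-≈ (+-identityˡ 0#) (+-mono-≤ (0≤f zero) (sum-nonNeg (0≤f ∘ suc)))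

  -- Chebyshev-type inequalities for antitone sequences.

  Antitone : ∀ {n} → Vector Carrier n → Set r
  Antitone c = ∀ {i j} → i Fin.≤ j → c j ≤ c i

  -- Equals Σ (i + 1) cᵢ for i counted from 0.
  suffixSums : ∀ {n} → Vector Carrier n → Carrier
  suffixSums {zero}  c = 0#
  suffixSums {suc n} c = sum c + suffixSums (tail c)

  -- Induction on the length, removing the largest entry: the hypothesis for the tail leaves `suc n`
  -- copies of the tail sum to be compared with full sums.
  chebyshev : ∀ {n} (c : Vector Carrier n) → Antitone c → 2 · suffixSums c ≤ suc n · sum c
  chebyshev {zero}  c anti = ≤-reflexive (+-congˡ (+-identityˡ 0#))
  chebyshev {suc n} c anti = begin
    2 · (sum c + suffixSums (tail c))           ≈⟨ ·-distrib-+ 2 _ _ ⟩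
    2 · sum c + 2 · suffixSums (tail c)         ≤⟨ +-monoʳ-≤ _ (chebyshev (tail c) (anti ∘ ℕ.s≤s)) ⟩
    -- One copy of the tail sum is traded for `n` copies of the head, which complete the other `n`
    -- copies to full sums.
    2 · sum c + suc n · sum (tail c)            ≤⟨ +-monoʳ-≤ _ (+-monoˡ-≤ _ sum-tail≤) ⟩
    2 · sum c + (n · head c + n · sum (tail c)) ≈⟨ +-congˡ (·-distrib-+ n _ _) ⟨
    2 · sum c + n · sum c                       ≈⟨ ×-homo-+ (sum c) 2 n ⟨
    (2 ℕ.+ n) · sum c                           ∎
    where
    sum-tail≤ : sum (tail c) ≤ n · head c
    sum-tail≤ = sum-≤-· {n} λ i → anti {j = suc i} ℕ.z≤n

  -- Applying `chebyshev` to the tail leaves exactly `suc n` copies of the tail sum, and the `suc n`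
  -- copies of the head on the left complete them to full sums.
  chebyshev-head : ∀ {n} (c : Vector Carrier (suc n)) → Antitone c →
    2 · suffixSums c + suc n · head c ≤ (3 ℕ.+ n) · sum c
  chebyshev-head {n} c anti = begin
    2 · (sum c + suffixSums (tail c)) + suc n · head c
      ≈⟨ +-congʳ (·-distrib-+ 2 _ _) ⟩
    2 · sum c + 2 · suffixSums (tail c) + suc n · head c
      ≤⟨ +-monoˡ-≤ _ (+-monoʳ-≤ _ (chebyshev (tail c) (anti ∘ ℕ.s≤s))) ⟩
    2 · sum c + suc n · sum (tail c) + suc n · head c
      ≈⟨ +-assoc _ _ _ ⟩
    2 · sum c + (suc n · sum (tail c) + suc n · head c)
      ≈⟨ +-congˡ (·-distrib-+ (suc n) _ _) ⟨
    2 · sum c + suc n · (sum (tail c) + head c)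
      ≈⟨ +-congˡ (×-congʳ (suc n) (+-comm _ _)) ⟩
    2 · sum c + suc n · sum c
      ≈⟨ ×-homo-+ (sum c) 2 (suc n) ⟨
    (3 ℕ.+ n) · sum c
      ∎

-- Costs of edge sets under original and reduced weights.

module _ {a b r : Level} (K : OrderedField a b r) where

  open OrderedFieldProperties K

  module _ (G : Graph) (w : Weighting K G) where

    open Graph G

    cost-nonNeg : ∀ F → 0# ≤ cost K G w F
    cost-nonNeg F = sum-nonNeg pointwise
      where
      pointwise : ∀ e → 0# ≤ (if lookup F e then Weighting.weight w e else 0#)
      pointwise e with lookup F e
      ... | true  = Weighting.nonNeg w e
      ... | false = ≤-refl

    cost-mono : ∀ {F F′} → F ⊆ F′ → cost K G w F ≤ cost K G w F′
    cost-mono {F} {F′} F⊆F′ = sum-mono-≤ pointwise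
      where
      pointwise : ∀ e → (if lookup F e then Weighting.weight w e else 0#)
                      ≤ (if lookup F′ e then Weighting.weight w e else 0#)
      pointwise e with lookup F e in e∈F | lookup F′ e in e∈F′
      ... | false | false = ≤-refl
      ... | false | true  = Weighting.nonNeg w e
      ... | true  | true  = ≤-refl
      ... | true  | false =
        contradiction (≡.trans (≡.sym e∈F′) ([]=⇒lookup (F⊆F′ (lookup⇒[]= e F e∈F)))) λ ()

    cost-zeroOn : ∀ H F → cost K G (zeroOn K G H w) F ≤ cost K G w F
    cost-zeroOn H F = sum-mono-≤ pointwise
      where
      pointwise : ∀ e → (if lookup F e then (if lookup H e then 0# else Weighting.weight w e) else 0#)
                      ≤ (if lookup F e then Weighting.weight w e else 0#)
      pointwise e with lookup F e | lookup H e
      ... | false | _     = ≤-refl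
      ... | true  | false = ≤-refl
      ... | true  | true  = Weighting.nonNeg w e

    -- An edge in both sets is charged only through `H`, since it is free after reweighting.
    cost-∪ : ∀ H F → cost K G w (H ∪ F) ≤ cost K G (zeroOn K G H w) F + cost K G w H
    cost-∪ H F = ≤-trans (sum-mono-≤ pointwise) (≤-reflexive (∑-distrib-+ {∣E∣} _ _))
      where
      pointwise : ∀ e → (if lookup (H ∪ F) e then Weighting.weight w e else 0#)
                      ≤ (if lookup F e then (if lookup H e then 0# else Weighting.weight w e) else 0#)
                        + (if lookup H e then Weighting.weight w e else 0#)
      pointwise e rewrite lookup-zipWith _∨_ e H F with lookup F e | lookup H e
      ... | false | false = ≤-reflexive (sym (+-identityˡ 0#))
      ... | false | true  = ≤-reflexive (sym (+-identityˡ _))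
      ... | true  | false = ≤-reflexive (sym (+-identityʳ _))
      ... | true  | true  = ≤-reflexive (sym (+-identityˡ _))

  -- Cost bounds for the subroutine and for both approaches.

  module _ {G : Graph} {ρ : Carrier} (0≤ρ : 0# ≤ ρ) (A : Subroutine K G ρ) where

    open Graph G
    open Subroutine A

    -- The subroutine competes with the cheapest Steiner tree, hence with the one inside `F`. Since
    -- `w` is arbitrary, the bound also applies to the reduced weights of the top-down approach.
    solve-cost : ∀ {F T} → Spans F T → ∀ w → cost K G w (edges (solve w T)) ≤ ρ * cost K G w F
    solve-cost {F} {T} spans w =
      let μ , isMin , solve≤ρμ = approx w T
          -- The returned tree provides the vertex needed in case `T` is empty.
          root , _ = Tree.nonempty (solve w T)
          S , S⊆F , steinerS = spans⇒steinerTree G spans root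
      in begin
        cost K G w (edges (solve w T))  ≤⟨ solve≤ρμ ⟩
        ρ * μ                           ≤⟨ *-monoˡ-≤-nonNeg 0≤ρ (IsMinimum.lowerBound isMin S steinerS) ⟩
        ρ * cost K G w (edges S)        ≤⟨ *-monoˡ-≤-nonNeg 0≤ρ (cost-mono G w S⊆F) ⟩
        ρ * cost K G w F                ∎

    module _ (w : Weighting K G) where

      -- The head is the union of all purchases made so far. The purchase at a level costs at most
      -- `ρ` times the reduced cost of `E` there, and reducing weights never raises a cost.
      topDown-head : ∀ {k} (T : Vector VertexSet (suc k)) (E : Vector EdgeSet (suc k)) →
        (∀ i → Spans (E i) (T i)) →
        cost K G w (head (topDown K A w T)) ≤ ρ * sum (cost K G w ∘ E)
      topDown-head {zero} T E spans =
        ≤-trans (solve-cost (spans zero) w) (≤-reflexive (*-congˡ (sym (+-identityʳ _))))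
      topDown-head {suc k} T E spans = begin
        cost K G w (H ∪ edges (solve w′ (head T)))
          ≤⟨ cost-∪ G w H _ ⟩
        cost K G w′ (edges (solve w′ (head T))) + cost K G w H
          ≤⟨ +-mono-≤ (solve-cost (spans zero) w′) (topDown-head (tail T) (tail E) (spans ∘ suc)) ⟩
        ρ * cost K G w′ (head E) + ρ * sum (cost K G w ∘ tail E)
          ≤⟨ +-monoˡ-≤ _ (*-monoˡ-≤-nonNeg 0≤ρ (cost-zeroOn G w H (head E))) ⟩
        ρ * cost K G w (head E) + ρ * sum (cost K G w ∘ tail E)
          ≈⟨ distribˡ ρ _ _ ⟨
        ρ * sum (cost K G w ∘ E)
          ∎
        where
        H : EdgeSet
        H = head (topDown K A w (tail T))

        w′ : Weighting K G
        w′ = zeroOn K G H w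

      -- `topDown-head` bounds each level by `ρ` times the suffix sum starting there; `suffixSums`
      -- adds these up.
      topDown-cost : ∀ {k} (T : Vector VertexSet (suc k)) (E : Vector EdgeSet (suc k)) →
        (∀ i → Spans (E i) (T i)) →
        sum (cost K G w ∘ topDown K A w T) ≤ ρ * suffixSums (cost K G w ∘ E)
      topDown-cost {zero} T E spans = begin
        cost K G w (head (topDown K A w T)) + 0#  ≤⟨ +-monoˡ-≤ 0# (topDown-head T E spans) ⟩
        ρ * sum (cost K G w ∘ E) + 0#             ≈⟨ +-congˡ (zeroʳ ρ) ⟨
        ρ * sum (cost K G w ∘ E) + ρ * 0#         ≈⟨ distribˡ ρ _ _ ⟨
        ρ * (sum (cost K G w ∘ E) + 0#)           ∎
      topDown-cost {suc k} T E spans = begin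
        cost K G w (head (topDown K A w T)) + sum (cost K G w ∘ topDown K A w (tail T))
          ≤⟨ +-mono-≤ (topDown-head T E spans) (topDown-cost (tail T) (tail E) (spans ∘ suc)) ⟩
        ρ * sum (cost K G w ∘ E) + ρ * suffixSums (cost K G w ∘ tail E)
          ≈⟨ distribˡ ρ _ _ ⟨
        ρ * suffixSums (cost K G w ∘ E)
          ∎

      bottomUp-cost : ∀ {k} (T : Vector VertexSet (suc k)) (B : BottomUp K A w T) {F} →
        Spans F (head T) →
        sum (cost K G w ∘ edges ∘ BottomUp.tree B) ≤ suc k · (ρ * cost K G w F)
      bottomUp-cost T B {F} spans = sum-≤-· level
        where
        level : ∀ i → cost K G w (edges (BottomUp.tree B i)) ≤ ρ * cost K G w F
        level zero    = solve-cost spans w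
        level (suc i) = ≤-trans
          (cost-mono G w (proj₂ (IsSmallestSubtree.subtree (BottomUp.smallest B i))))
          (solve-cost spans w)

-- The three approximation guarantees.

theorem2p1 : ∀ {a b r : Level} (K : OrderedField a b r) (k : ℕ) →
    let open OrderedField K
        ℓ = suc (suc k)
    in
    (ρ : Carrier) → 1# ≤ ρ →
    (I : Instance K ℓ) (A : Subroutine K (Instance.graph I) ρ)
    (B : BottomUp K A (Instance.weighting I) (Instance.terminals I))
    (OPT : Carrier) → Instance.IsOPT I OPT →
    (TOP K I A ≤ fromNat (suc ℓ) / fromNat 2 * ρ * OPT)
    × (BOT K I A B ≤ fromNat ℓ * ρ * OPT)
    × (TOP K I A ⊓ BOT K I A B ≤ fromNat (suc (suc ℓ)) / fromNat 3 * ρ * OPT)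
theorem2p1 K k ρ 1≤ρ I A B OPT isOPT =
    -- The first argument of `≤-divide` is the predecessor of the denominator: 1 for halves, 2 for
    -- thirds.
    ≤-respʳ-≈ (sym (*-assoc _ ρ OPT)) (≤-divide 1 (suc ℓ) 2TOP≤)
  , BOT≤
  , ≤-respʳ-≈ (sym (*-assoc _ ρ OPT)) (≤-divide 2 (suc (suc ℓ)) 3min≤)
  where
  open OrderedFieldProperties K
  open Instance I using (graph; weighting; terminals; EdgeSet)

  ℓ : ℕ
  ℓ = suc (suc k)

  0≤ρ : 0# ≤ ρ
  0≤ρ = ≤-trans 0≤1 1≤ρ

  E : Vector EdgeSet ℓ
  E = proj₁ (IsMinimum.attained isOPT)

  isMLST : Instance.IsMLST I E
  isMLST = proj₁ (proj₂ (IsMinimum.attained isOPT))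

  c : Vector Carrier ℓ
  c = cost K graph weighting ∘ E

  sum-c≈OPT : sum c ≈ OPT
  sum-c≈OPT = proj₂ (proj₂ (IsMinimum.attained isOPT))

  antitone : Antitone c
  antitone i≤j = cost-mono K graph weighting (Instance.IsMLST.nestedEdges isMLST i≤j)

  spans : ∀ i → Graph.Spans graph (E i) (terminals i)
  spans = Instance.IsMLST.spans isMLST

  topCost botCost : Carrier
  topCost = TOP K I A
  botCost = BOT K I A B

  top≤ : topCost ≤ ρ * suffixSums c
  top≤ = topDown-cost K 0≤ρ A weighting terminals E spans

  bot≤ : botCost ≤ ℓ · (ρ * head c)
  bot≤ = bottomUp-cost K 0≤ρ A weighting terminals B (spans zero)

  -- Transfers a bound on the level costs of the optimal solution to one in terms of `ρ * OPT`.
  ρ·-≤ : ∀ n {x} → x ≤ n · sum c → ρ * x ≤ n · (ρ * OPT)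
  ρ·-≤ n {x} x≤ = begin
    ρ * x            ≤⟨ *-monoˡ-≤-nonNeg 0≤ρ x≤ ⟩
    ρ * (n · sum c)  ≈⟨ ×-comm-* n ρ (sum c) ⟩
    n · (ρ * sum c)  ≈⟨ ×-congʳ n (*-congˡ sum-c≈OPT) ⟩
    n · (ρ * OPT)    ∎

  2TOP≤ : 2 · topCost ≤ suc ℓ · (ρ * OPT)
  2TOP≤ = begin
    2 · topCost             ≤⟨ ·-mono-≤ 2 top≤ ⟩
    2 · (ρ * suffixSums c)  ≈⟨ ×-comm-* 2 ρ _ ⟨
    ρ * (2 · suffixSums c)  ≤⟨ ρ·-≤ (suc ℓ) (chebyshev c antitone) ⟩
    suc ℓ · (ρ * OPT)       ∎

  head-c≤sum-c : head c ≤ sum c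
  head-c≤sum-c = ≤-respˡ-≈ (+-identityʳ _)
    (+-monoʳ-≤ (head c) (sum-nonNeg λ i → cost-nonNeg K graph weighting (E (suc i))))

  BOT≤ : botCost ≤ fromNat ℓ * ρ * OPT
  BOT≤ = begin
    botCost               ≤⟨ bot≤ ⟩
    ℓ · (ρ * head c)      ≈⟨ ×-comm-* ℓ ρ _ ⟨
    ρ * (ℓ · head c)      ≤⟨ ρ·-≤ ℓ (·-mono-≤ ℓ head-c≤sum-c) ⟩
    ℓ · (ρ * OPT)         ≈⟨ fromNat-* ℓ (ρ * OPT) ⟨
    fromNat ℓ * (ρ * OPT) ≈⟨ *-assoc _ ρ OPT ⟨
    fromNat ℓ * ρ * OPT   ∎

  3min≤ : 3 · (topCost ⊓ botCost) ≤ suc (suc ℓ) · (ρ * OPT)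
  3min≤ = begin
    3 · (topCost ⊓ botCost)
      -- Two copies of the minimum are bounded by the top-down cost and one by the bottom-up cost,
      -- the proportion for which `chebyshev-head` is made.
      ≈⟨ ×-homo-+ _ 2 1 ⟩
    2 · (topCost ⊓ botCost) + 1 · (topCost ⊓ botCost)
      ≤⟨ +-mono-≤ (·-mono-≤ 2 (x⊓y≤x topCost botCost)) (·-mono-≤ 1 (x⊓y≤y topCost botCost)) ⟩
    2 · topCost + 1 · botCost
      ≈⟨ +-congˡ (×-homo-1 botCost) ⟩
    2 · topCost + botCost
      ≤⟨ +-mono-≤ (·-mono-≤ 2 top≤) bot≤ ⟩
    2 · (ρ * suffixSums c) + ℓ · (ρ * head c)
      ≈⟨ +-cong (×-comm-* 2 ρ _) (×-comm-* ℓ ρ _) ⟨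
    ρ * (2 · suffixSums c) + ρ * (ℓ · head c)
      ≈⟨ distribˡ ρ _ _ ⟨
    ρ * (2 · suffixSums c + ℓ · head c)
      ≤⟨ ρ·-≤ (suc (suc ℓ)) (chebyshev-head c antitone) ⟩
    suc (suc ℓ) · (ρ * OPT)
      ∎
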